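{- Let $p$ be a prime, let $m\ge 0$ be an integer, and let $f:\mathbb{Z}_p\to\mathbb{Z}_p$ be an arithmetic differential operator of order $m$. Then $f$ is an analytic function of level $m$.
   Context: $\mathbb{Z}_p$ denotes the ring of $p$-adic integers with the $p$-adic norm $|\cdot|_p$, $|p|_p=p^{ -1}$. The Fermat quotient operator is $\delta:\mathbb{Z}_p\to\mathbb{Z}_p$, $\delta a=(a-a^p)/p$, and $\delta^i$ denotes its $i$-th iterate. A power series $F=\sum_{\alpha} a_\alpha x^\alpha\in\mathbb{Z}_p[[x_0,\dots,x_k]]$ is called restricted if $a_\alpha\to 0$ $p$-adically as $|\alpha|=\alpha_0+\dots+\alpha_k\to\infty$. A function $f:\mathbb{Z}_p\to\mathbb{Z}_p$ is an arithmetic differential operator of order $m$ if there is a restricted power series $F\in\mathbb{Z}_p[[x_0,\dots,x_m]]$ with $f(a)=F(a,\delta a,\dots,\delta^m a)$ for all $a\in\mathbb{Z}_p$. A function $f:\mathbb{Z}_p\to\mathbb{Z}_p$ is analytic of level $m$ if for every $a\in\mathbb{Z}_p$ there is a restricted power series $F_a\in\mathbb{Z}_p[[x]]$ (one variable) such that $f(a+p^m u)=F_a(u)$ for all $u\in\mathbb{Z}_p$. -}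

module Defs where

open import Algebra.Bundles using (CommutativeRing; Semiring)
open import Algebra.Structures using (IsCommutativeRing)
open import Data.Empty using (⊥-elim)
open import Data.Fin.Base using (Fin; zero; suc; toℕ; fromℕ; inject₁)
open import Data.Fin.Properties using (toℕ-fromℕ; toℕ-inject₁; toℕ<n)
open import Data.Integer.Base as ℤ using (ℤ; +_; -[1+_])
import Data.Integer.Properties as ℤ
open import Data.Integer.Divisibility.Signed as ℤ∣ using (divides) renaming (_∣_ to _∣ℤ_)
open import Data.Integer.Tactic.RingSolver using (solve-∀)
open import Data.Nat.Base as ℕ using (ℕ; zero; suc; _≤_; _<_; _!; NonZero)
import Data.Nat.Properties as ℕ
import Data.Nat.DivMod as ℕ
import Data.Nat.Divisibility as ℕ∣
open import Data.Nat.Combinatorics using (_C_; nCk≡n!/k![n-k]!; k![n∸k]!∣n!; nCn≡1)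
open import Data.Nat.Primality using (Prime; euclidsLemma; prime⇒nonZero; ¬prime[1])
open import Data.Product.Base using (∃; _×_; _,_)
open import Data.Sum.Base using (inj₁; inj₂)
open import Data.Vec.Base using (Vec; []; _∷_; sum; iterate)
open import Function.Bundles using (Func; _⟨$⟩_)
open import Level using (0ℓ)
open import Relation.Binary.Structures using (IsEquivalence)
open import Relation.Binary.PropositionalEquality using (_≡_; refl; sym; trans; cong; cong₂; subst; subst₂)
open import Relation.Nullary.Negation.Core using (¬_)

module Fermat (p : ℕ) (p-prime : Prime p) where

  private
    instance
      p≢0 : NonZero p
      p≢0 = prime⇒nonZero p-prime

    ℤ-semiring : Semiring 0ℓ 0ℓ
    ℤ-semiring = CommutativeRing.semiring ℤ.+-*-commutativeRing

    ℤ-commutativeSemiring = CommutativeRing.commutativeSemiring ℤ.+-*-commutativeRing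

  open import Algebra.Properties.Semiring.Exp ℤ-semiring public using (_^_)

  private
    open import Algebra.Properties.Semiring.Sum ℤ-semiring using (sum-init-last) renaming (sum to ∑)
    open import Algebra.Properties.Monoid.Mult ℤ.+-0-monoid using (×-homo-1) renaming (_×_ to _·_)
    open import Algebra.Properties.CommutativeSemiring.Binomial ℤ-commutativeSemiring using (binomial; binomialTerm; theorem)

    p∤k! : ∀ k → k < p → ¬ (p ℕ∣.∣ k !)
    p∤k! zero    _   p∣1 = ¬prime[1] (subst Prime (ℕ∣.∣1⇒≡1 p∣1) p-prime)
    p∤k! (suc k) k<p p∣  with euclidsLemma (suc k) (k !) p-prime p∣
    ... | inj₁ p∣sk = ℕ.<⇒≱ k<p (ℕ∣.∣⇒≤ p∣sk)
    ... | inj₂ p∣k! = p∤k! k (ℕ.<-trans (ℕ.n<1+n k) k<p) p∣k!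

    n∣n! : ∀ n .{{_ : NonZero n}} → n ℕ∣.∣ n !
    n∣n! (suc n) = ℕ∣.m∣m*n (n !)

    p∣pCk : ∀ k → 0 < k → k < p → p ℕ∣.∣ p C k
    p∣pCk k 0<k k<p with euclidsLemma (p C k) (k ! ℕ.* (p ℕ.∸ k) !) p-prime p∣prod
      where
      k≤p = ℕ.<⇒≤ k<p
      instance
        _ : NonZero (k ! ℕ.* (p ℕ.∸ k) !)
        _ = ℕ._!*_!≢0 k (p ℕ.∸ k)
      p∣prod : p ℕ∣.∣ (p C k) ℕ.* (k ! ℕ.* (p ℕ.∸ k) !)
      p∣prod = subst (p ℕ∣.∣_)
        (sym (trans (cong (ℕ._* (k ! ℕ.* (p ℕ.∸ k) !)) (nCk≡n!/k![n-k]! k≤p))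
                    (ℕ.m/n*n≡m (k![n∸k]!∣n! k≤p))))
        (n∣n! p)
    ... | inj₁ p∣C = p∣C
    ... | inj₂ p∣k![p-k]! with euclidsLemma (k !) ((p ℕ.∸ k) !) p-prime p∣k![p-k]!
    ...   | inj₁ p∣k! = ⊥-elim (p∤k! k k<p p∣k!)
    ...   | inj₂ p∣[p-k]! = ⊥-elim (p∤k! (p ℕ.∸ k) (ℕ.∸-monoʳ-< 0<k (ℕ.<⇒≤ k<p)) p∣[p-k]!)

    ·≡* : ∀ n x → n · x ≡ + n ℤ.* x
    ·≡* zero    x = refl
    ·≡* (suc n) x = trans (cong (λ t → x ℤ.+ t) (·≡* n x)) (sym (ℤ.suc-* (+ n) x))

    ∣∑ : ∀ {d} n (t : Fin n → ℤ) → (∀ i → d ∣ℤ t i) → d ∣ℤ ∑ t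
    ∣∑ {d} zero    t d∣t = divides (+ 0) (sym (ℤ.*-zeroˡ d))
    ∣∑     (suc n) t d∣t = ℤ∣.∣m∣n⇒∣m+n (d∣t zero) (∣∑ n (λ i → t (suc i)) (λ i → d∣t (suc i)))

    1^ : ∀ n → (+ 1) ^ n ≡ + 1
    1^ zero    = refl
    1^ (suc n) = trans (ℤ.*-identityˡ _) (1^ n)

    freshman : ∀ z → + p ∣ℤ (z ℤ.+ + 1) ^ p ℤ.- (z ^ p ℤ.+ + 1)
    freshman z = go p refl
      where
      go : ∀ q → q ≡ p → + p ∣ℤ (z ℤ.+ + 1) ^ q ℤ.- (z ^ q ℤ.+ + 1)
      go zero    q≡p = ⊥-elim (ℕ.≢-nonZero⁻¹ p (sym q≡p))
      go (suc q) q≡p = subst (+ p ∣ℤ_) eq (∣∑ q mid p∣mid)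
        where
        t : Fin (suc (suc q)) → ℤ
        t = binomialTerm z (+ 1) (suc q)
        mid : Fin q → ℤ
        mid i = t (suc (inject₁ i))
        last = t (suc (fromℕ q))
        p∣mid : ∀ i → + p ∣ℤ mid i
        p∣mid i = subst (+ p ∣ℤ_) (sym (·≡* (suc q C toℕ (suc (inject₁ i))) (binomial z (+ 1) (suc q) (suc (inject₁ i)))))
          (ℤ∣.∣m⇒∣m*n {m = + (suc q C toℕ (suc (inject₁ i)))} (binomial z (+ 1) (suc q) (suc (inject₁ i))) (ℤ∣.∣ᵤ⇒∣ {i = + (suc q C toℕ (suc (inject₁ i)))} p∣C))
          where
          i<q : toℕ (inject₁ i) < q
          i<q = subst (_< q) (sym (toℕ-inject₁ i)) (toℕ<n i)
          p∣C : p ℕ∣.∣ suc q C toℕ (suc (inject₁ i))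
          p∣C = subst (λ r → p ℕ∣.∣ r C suc (toℕ (inject₁ i))) (sym q≡p)
            (p∣pCk _ (ℕ.s≤s ℕ.z≤n) (subst (suc (toℕ (inject₁ i)) <_) q≡p (ℕ.s≤s i<q)))
        first≡ : t zero ≡ + 1
        first≡ = trans (×-homo-1 _) (trans (ℤ.*-identityˡ _) (1^ (suc q)))
        last≡ : last ≡ z ^ suc q
        last≡ rewrite toℕ-fromℕ q | nCn≡1 (suc q) | ℕ.n∸n≡0 q =
          trans (×-homo-1 _) (ℤ.*-identityʳ _)
        alg : ∀ s f l → s ≡ (f ℤ.+ (s ℤ.+ l)) ℤ.- (l ℤ.+ f)
        alg = solve-∀
        eq : ∑ mid ≡ (z ℤ.+ + 1) ^ suc q ℤ.- (z ^ suc q ℤ.+ + 1)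
        eq = trans (alg (∑ mid) (t zero) last)
               (cong₂ ℤ._-_
                 (sym (trans (theorem (suc q) z (+ 1))
                             (cong (λ r → t zero ℤ.+ r) (sum-init-last (λ i → t (suc i))))))
                 (cong₂ ℤ._+_ last≡ first≡))

  fermat : ∀ z → + p ∣ℤ z ℤ.- z ^ p
  fermat = λ where
      (+ n)    → pos n
      -[1+ n ] → neg (suc n)
    where
    up-alg : ∀ z a b → (z ℤ.- a) ℤ.- (b ℤ.- (a ℤ.+ + 1)) ≡ (z ℤ.+ + 1) ℤ.- b
    up-alg = solve-∀
    down-alg : ∀ z a b → ((z ℤ.+ + 1) ℤ.- b) ℤ.+ (b ℤ.- (a ℤ.+ + 1)) ≡ z ℤ.- a
    down-alg = solve-∀
    up : ∀ z → + p ∣ℤ z ℤ.- z ^ p → + p ∣ℤ (z ℤ.+ + 1) ℤ.- (z ℤ.+ + 1) ^ p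
    up z h = subst (+ p ∣ℤ_) (up-alg z (z ^ p) _) (ℤ∣.∣m∣n⇒∣m-n h (freshman z))
    down : ∀ z → + p ∣ℤ (z ℤ.+ + 1) ℤ.- (z ℤ.+ + 1) ^ p → + p ∣ℤ z ℤ.- z ^ p
    down z h = subst (+ p ∣ℤ_) (down-alg z (z ^ p) _) (ℤ∣.∣m∣n⇒∣m+n h (freshman z))
    0^ : ∀ n .{{_ : NonZero n}} → (+ 0) ^ n ≡ + 0
    0^ (suc n) = refl
    pos : ∀ n → + p ∣ℤ + n ℤ.- (+ n) ^ p
    pos zero    = subst (λ t → + p ∣ℤ + 0 ℤ.- t) (sym (0^ p)) (divides (+ 0) refl)
    pos (suc n) = subst (λ z → + p ∣ℤ z ℤ.- z ^ p) (cong +_ (ℕ.+-comm n 1)) (up (+ n) (pos n))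
    neg-suc : ∀ n → ℤ.- (+ suc n) ℤ.+ + 1 ≡ ℤ.- (+ n)
    neg-suc zero    = refl
    neg-suc (suc n) = refl
    neg : ∀ n → + p ∣ℤ ℤ.- (+ n) ℤ.- (ℤ.- (+ n)) ^ p
    neg zero    = pos zero
    neg (suc n) = down (ℤ.- (+ suc n))
      (subst (λ z → + p ∣ℤ z ℤ.- z ^ p) (sym (neg-suc n)) (neg n))

module Padic (p : ℕ) (p-prime : Prime p) where

  private
    instance
      p≢0 : NonZero p
      p≢0 = prime⇒nonZero p-prime

  p^ : ℕ → ℤ
  p^ n = + (p ℕ.^ n)

  -- ℤₚ is the inverse limit of the rings ℤ/pⁿ: a compatible family of residue classes, each
  -- given by an integer representative, two families being equal when they agree in every ℤ/pⁿ.
  record ℤₚ : Set where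
    no-eta-equality
    constructor mkℤₚ
    field
      residue    : ℕ → ℤ
      compatible : ∀ n → p^ n ∣ℤ residue (suc n) ℤ.- residue n

  open ℤₚ public

  infix 4 _≈_

  record _≈_ (x y : ℤₚ) : Set where
    no-eta-equality
    constructor mk≈
    field
      agree : ∀ n → p^ n ∣ℤ residue x n ℤ.- residue y n

  open _≈_ public

  private
    ∣0 : ∀ d → d ∣ℤ + 0
    ∣0 d = divides (+ 0) refl

    pointwise : ∀ {x y} → (∀ n → residue x n ≡ residue y n) → x ≈ y
    pointwise {x} {y} h = mk≈ λ n → subst (p^ n ∣ℤ_) (sym (ℤ.i≡j⇒i-j≡0 (h n))) (∣0 _)

    +-diff : ∀ a b c d → (a ℤ.- c) ℤ.+ (b ℤ.- d) ≡ (a ℤ.+ b) ℤ.- (c ℤ.+ d)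
    +-diff = solve-∀

    *-diff : ∀ a b c d → (a ℤ.- c) ℤ.* b ℤ.+ c ℤ.* (b ℤ.- d) ≡ a ℤ.* b ℤ.- c ℤ.* d
    *-diff = solve-∀

    neg-diff : ∀ a c → ℤ.- (a ℤ.- c) ≡ ℤ.- a ℤ.- ℤ.- c
    neg-diff = solve-∀

    sym-diff : ∀ a c → ℤ.- (a ℤ.- c) ≡ c ℤ.- a
    sym-diff = solve-∀

    trans-diff : ∀ a b c → (a ℤ.- b) ℤ.+ (b ℤ.- c) ≡ a ℤ.- c
    trans-diff = solve-∀

    ∣+ : ∀ {k} a b c d → k ∣ℤ a ℤ.- c → k ∣ℤ b ℤ.- d → k ∣ℤ (a ℤ.+ b) ℤ.- (c ℤ.+ d)
    ∣+ {k} a b c d h h′ = subst (k ∣ℤ_) (+-diff a b c d) (ℤ∣.∣m∣n⇒∣m+n h h′)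

    ∣* : ∀ {k} a b c d → k ∣ℤ a ℤ.- c → k ∣ℤ b ℤ.- d → k ∣ℤ a ℤ.* b ℤ.- c ℤ.* d
    ∣* {k} a b c d h h′ = subst (k ∣ℤ_) (*-diff a b c d)
      (ℤ∣.∣m∣n⇒∣m+n (ℤ∣.∣m⇒∣m*n b h) (ℤ∣.∣n⇒∣m*n c h′))

    ∣neg : ∀ {k} a c → k ∣ℤ a ℤ.- c → k ∣ℤ ℤ.- a ℤ.- ℤ.- c
    ∣neg {k} a c h = subst (k ∣ℤ_) (neg-diff a c) (ℤ∣.∣m⇒∣-m h)

    ∣sym : ∀ {k} a c → k ∣ℤ a ℤ.- c → k ∣ℤ c ℤ.- a
    ∣sym {k} a c h = subst (k ∣ℤ_) (sym-diff a c) (ℤ∣.∣m⇒∣-m h)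

    ∣trans : ∀ {k} a b c → k ∣ℤ a ℤ.- b → k ∣ℤ b ℤ.- c → k ∣ℤ a ℤ.- c
    ∣trans {k} a b c h h′ = subst (k ∣ℤ_) (trans-diff a b c) (ℤ∣.∣m∣n⇒∣m+n h h′)

  fromℤ : ℤ → ℤₚ
  fromℤ z .residue    _ = z
  fromℤ z .compatible n = subst (p^ n ∣ℤ_) (sym (ℤ.i≡j⇒i-j≡0 {z} refl)) (∣0 _)

  infixl 6 _+ₚ_
  infixl 7 _*ₚ_
  infix  8 -ₚ_

  _+ₚ_ : ℤₚ → ℤₚ → ℤₚ
  (x +ₚ y) .residue    n = residue x n ℤ.+ residue y n
  (x +ₚ y) .compatible n = ∣+ (residue x (suc n)) _ _ _ (compatible x n) (compatible y n)

  _*ₚ_ : ℤₚ → ℤₚ → ℤₚ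
  (x *ₚ y) .residue    n = residue x n ℤ.* residue y n
  (x *ₚ y) .compatible n = ∣* (residue x (suc n)) _ _ _ (compatible x n) (compatible y n)

  -ₚ_ : ℤₚ → ℤₚ
  (-ₚ x) .residue    n = ℤ.- residue x n
  (-ₚ x) .compatible n = ∣neg (residue x (suc n)) _ (compatible x n)

  private
    ≈-isEquivalence : IsEquivalence _≈_
    ≈-isEquivalence = record
      { refl  = pointwise λ _ → refl
      ; sym   = λ {x} {y} h → mk≈ λ n → ∣sym (residue x n) _ (agree h n)
      ; trans = λ {x} {y} {z} h h′ → mk≈ λ n → ∣trans (residue x n) (residue y n) _ (agree h n) (agree h′ n)
      }

    isCommutativeRing : IsCommutativeRing _≈_ _+ₚ_ _*ₚ_ -ₚ_ (fromℤ (+ 0)) (fromℤ (+ 1))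
    isCommutativeRing = record
      { isRing = record
        { +-isAbelianGroup = record
          { isGroup = record
            { isMonoid = record
              { isSemigroup = record
                { isMagma = record
                  { isEquivalence = ≈-isEquivalence
                  ; ∙-cong = λ {x} h h′ → mk≈ λ n → ∣+ (residue x n) _ _ _ (agree h n) (agree h′ n)
                  }
                ; assoc = λ x y z → pointwise λ n → ℤ.+-assoc (residue x n) _ _
                }
              ; identity = (λ x → pointwise λ n → ℤ.+-identityˡ _) , (λ x → pointwise λ n → ℤ.+-identityʳ _)
              }
            ; inverse = (λ x → pointwise λ n → ℤ.+-inverseˡ (residue x n)) , (λ x → pointwise λ n → ℤ.+-inverseʳ (residue x n))
            ; ⁻¹-cong = λ {x} h → mk≈ λ n → ∣neg (residue x n) _ (agree h n)
            }
          ; comm = λ x y → pointwise λ n → ℤ.+-comm (residue x n) _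
          }
        ; *-cong = λ {x} h h′ → mk≈ λ n → ∣* (residue x n) _ _ _ (agree h n) (agree h′ n)
        ; *-assoc = λ x y z → pointwise λ n → ℤ.*-assoc (residue x n) _ _
        ; *-identity = (λ x → pointwise λ n → ℤ.*-identityˡ _) , (λ x → pointwise λ n → ℤ.*-identityʳ _)
        ; distrib = (λ x y z → pointwise λ n → ℤ.*-distribˡ-+ (residue x n) (residue y n) (residue z n)) , (λ x y z → pointwise λ n → ℤ.*-distribʳ-+ (residue x n) (residue y n) (residue z n))
        }
      ; *-comm = λ x y → pointwise λ n → ℤ.*-comm (residue x n) _
      }

  ℤₚ-ring : CommutativeRing 0ℓ 0ℓ
  ℤₚ-ring = record { isCommutativeRing = isCommutativeRing }

  open CommutativeRing ℤₚ-ring public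
    using (_+_; _*_; _-_; 0#; 1#; setoid; semiring)
  open import Algebra.Properties.Semiring.Exp semiring public using (_^_)
  open import Algebra.Properties.Semiring.Sum semiring public using (sum-syntax)
  open import Algebra.Properties.Semiring.Divisibility semiring public using (_∣_)
  open import Algebra.Definitions.RawMagma (Semiring.*-rawMagma semiring) using (_∣ʳ_; _,_)

  p# : ℤₚ
  p# = fromℤ (+ p)

  private
    residue-p#^ : ∀ n k → residue (p# ^ n) k ≡ p^ n
    residue-p#^ zero    k = refl
    residue-p#^ (suc n) k = trans (cong (+ p ℤ.*_) (residue-p#^ n k)) (sym (ℤ.pos-* p (p ℕ.^ n)))

    p^-+ : ∀ m n → p^ (m ℕ.+ n) ≡ p^ m ℤ.* p^ n
    p^-+ m n = trans (cong +_ (ℕ.^-distribˡ-+-* p m n)) (ℤ.pos-* (p ℕ.^ m) (p ℕ.^ n))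

    compatible+ : ∀ x n k → p^ n ∣ℤ residue x (k ℕ.+ n) ℤ.- residue x n
    compatible+ x n zero    = fromℤ (residue x n) .compatible n
    compatible+ x n (suc k) = ∣trans (residue x (suc k ℕ.+ n)) (residue x (k ℕ.+ n)) _
      (ℤ∣.∣-trans (divides (p^ k) (p^-+ k n)) (compatible x (k ℕ.+ n)))
      (compatible+ x n k)

  p#^n∣x⇒pⁿ∣residue : ∀ n x → p# ^ n ∣ x → p^ n ∣ℤ residue x n
  p#^n∣x⇒pⁿ∣residue n x (q , eq) =
    ℤ∣.∣m+n∣m⇒∣n
      (subst (p^ n ∣ℤ_) (sym (split (residue x n) (residue (q * p# ^ n) n)))
        (∣sym (residue (q * p# ^ n) n) (residue x n) (agree eq n)))
      (ℤ∣.∣m⇒∣-m (divides (residue q n) (cong (residue q n ℤ.*_) (residue-p#^ n n))))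
    where
    split : ∀ a b → ℤ.- b ℤ.+ a ≡ a ℤ.- b
    split a b = ℤ.+-comm (ℤ.- b) a

  pⁿ∣residue⇒p#^n∣x : ∀ n x → p^ n ∣ℤ residue x n → p# ^ n ∣ x
  pⁿ∣residue⇒p#^n∣x n x h = q , mk≈ λ k →
      subst (λ t → p^ k ∣ℤ t ℤ.- residue x k)
        (trans (q-eq k) (cong (residue q k ℤ.*_) (sym (residue-p#^ n k))))
        (subst (λ j → p^ k ∣ℤ residue x j ℤ.- residue x k) (ℕ.+-comm n k) (compatible+ x k n))
    where
    instance
      _ : ℤ.NonZero (p^ n)
      _ = ℕ.m^n≢0 p n
    cancel : ∀ a b → (a ℤ.- b) ℤ.+ b ≡ a
    cancel = solve-∀
    h′ : ∀ k → p^ n ∣ℤ residue x (k ℕ.+ n)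
    h′ k = subst (p^ n ∣ℤ_) (cancel (residue x (k ℕ.+ n)) (residue x n)) (ℤ∣.∣m∣n⇒∣m+n (compatible+ x n k) h)
    diff : ∀ a b c → a ℤ.* c ℤ.- b ℤ.* c ≡ (a ℤ.- b) ℤ.* c
    diff = solve-∀
    q : ℤₚ
    q .residue    k = ℤ∣.quotient (h′ k)
    q .compatible k = ℤ∣.*-cancelʳ-∣ (p^ n)
      (subst₂ _∣ℤ_ (p^-+ k n)
        (trans (cong₂ ℤ._-_ (ℤ∣._∣_.equality (h′ (suc k))) (ℤ∣._∣_.equality (h′ k)))
               (diff (q .residue (suc k)) (q .residue k) (p^ n)))
        (compatible x (k ℕ.+ n)))
    q-eq : ∀ k → residue x (k ℕ.+ n) ≡ residue q k ℤ.* p^ n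
    q-eq k = ℤ∣._∣_.equality (h′ k)

  private
    residue-^ : ∀ a n k → residue (a ^ n) k ≡ Fermat._^_ p p-prime (residue a k) n
    residue-^ a zero    k = refl
    residue-^ a (suc n) k = cong (residue a k ℤ.*_) (residue-^ a n k)

    p∣residue : ∀ a → p^ 1 ∣ℤ residue (a - a ^ p) 1
    p∣residue a = subst₂ _∣ℤ_ (cong +_ (sym (ℕ.*-identityʳ p)))
      (cong (λ r → residue a 1 ℤ.- r) (sym (residue-^ a p 1)))
      (Fermat.fermat p p-prime (residue a 1))

    p#^1∣x⇒p#∣x : ∀ x → p# ^ 1 ∣ x → p# ∣ x
    p#^1∣x⇒p#∣x x (q , eq) = q , R.trans (R.*-congˡ {q} (R.sym (R.*-identityʳ p#))) eq
      where module R = CommutativeRing ℤₚ-ring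

  p∣a-aᵖ : ∀ a → p# ∣ a - a ^ p
  p∣a-aᵖ a = p#^1∣x⇒p#∣x (a - a ^ p) (pⁿ∣residue⇒p#^n∣x 1 (a - a ^ p) (p∣residue a))

  -- δ a = (a − aᵖ)/p; the quotient is unique up to ≈ because ℤₚ has no p-torsion.
  δ : ℤₚ → ℤₚ
  δ a = _∣ʳ_.quotient (p∣a-aᵖ a)

  p*δa≈a-aᵖ : ∀ a → p# * δ a ≈ a - a ^ p
  p*δa≈a-aᵖ a = R.trans (R.*-comm p# (δ a)) (_∣ʳ_.equality (p∣a-aᵖ a))
    where module R = CommutativeRing ℤₚ-ring

  -- |x|ₚ ≤ p⁻ⁿ.  The value |x|ₚ itself is not computable, since x ≈ 0# is undecidable.
  ∣_∣≤p^-_ : ℤₚ → ℕ → Set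
  ∣ x ∣≤p^- n = p# ^ n ∣ x

  _⟶_ : (ℕ → ℤₚ) → ℤₚ → Set
  s ⟶ l = ∀ n → ∃ λ K → ∀ M → K ≤ M → ∣ s M - l ∣≤p^- n

  PowerSeries : ℕ → Set
  PowerSeries k = Vec ℕ k → ℤₚ

  Restricted : ∀ {k} → PowerSeries k → Set
  Restricted F = ∀ n → ∃ λ K → ∀ α → K ≤ sum α → ∣ F α ∣≤p^- n

  monomial : ∀ {k} → Vec ℤₚ k → Vec ℕ k → ℤₚ
  monomial []       []       = 1#
  monomial (x ∷ xs) (i ∷ α) = x ^ i * monomial xs α

  -- Sum of g α over the multi-indices α with all entries < M.
  ∑box : ∀ k → ℕ → (Vec ℕ k → ℤₚ) → ℤₚ
  ∑box zero    M g = g []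
  ∑box (suc k) M g = ∑[ i < M ] ∑box k M (λ α → g (toℕ i ∷ α))

  -- F(x) = y.  For restricted F the terms tend to 0, so the series converges unconditionally
  -- and the limit along boxes is its sum.
  _[_]≈_ : ∀ {k} → PowerSeries k → Vec ℤₚ k → ℤₚ → Set
  _[_]≈_ {k} F x y = (λ M → ∑box k M (λ α → F α * monomial x α)) ⟶ y

  -- iterate δ a (suc m) is the vector (a, δ a, …, δᵐ a).
  IsArithmeticDifferentialOperator : ℕ → Func setoid setoid → Set
  IsArithmeticDifferentialOperator m f =
    ∃ λ (F : PowerSeries (suc m)) →
      Restricted F × (∀ a → F [ iterate δ a (suc m) ]≈ (f ⟨$⟩ a))

  IsAnalytic : ℕ → Func setoid setoid → Set
  IsAnalytic m f =
    ∀ a → ∃ λ (Fₐ : PowerSeries 1) →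
      Restricted Fₐ × (∀ u → Fₐ [ u ∷ [] ]≈ (f ⟨$⟩ (a + p# ^ m * u)))

{-# OPTIONS --safe #-}
module Submission where

-- If x = c + pⁿ⁺¹ q with q ∈ ℤₚ[u], then xᵖ = cᵖ + pⁿ⁺¹ q h with h ∈ ℤₚ[u], and dividing
-- x − xᵖ by p gives δ x = δ c + pⁿ (q − q h).  Hence each of the m + 1 entries δⁱ(a + pᵐ u),
-- i ≤ m, is a polynomial in u over ℤₚ.  Substituting these polynomials into a restricted
-- series F, the partial sums over boxes are polynomials in u whose coefficients converge
-- uniformly in the degree, so their limits are the coefficients of a restricted series in u.

open import Defs
open import Algebra.Bundles using (CommutativeRing)
open import Data.Fin.Base using (Fin; zero; suc; toℕ)
open import Data.Integer.Base as ℤ using (+_)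
import Data.Integer.Properties as ℤ
open import Data.Integer.Divisibility.Signed as ℤ∣ using (divides) renaming (_∣_ to _∣ℤ_)
open import Data.Integer.Tactic.RingSolver using () renaming (solve-∀ to solve-ℤ)
open import Data.List.Base using (List; []; _∷_; length; map)
open import Data.Nat using (ℕ; zero; suc; _≤_; _⊔_; z≤n; s≤s; NonZero)
import Data.Nat as ℕ
import Data.Nat.Properties as ℕ
open import Data.Nat.Primality using (Prime; prime⇒nonZero)
open import Data.Product.Base using (_,_; proj₁; proj₂)
open import Data.Vec.Base using (Vec; []; _∷_; sum; iterate)
open import Data.Vec.Relation.Binary.Pointwise.Inductive using (Pointwise; []; _∷_)
open import Function.Base using (_∘_)
open import Function.Bundles using (Func)
open import Level using (0ℓ)
open import Relation.Binary.Bundles using (Setoid)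
open import Relation.Binary.PropositionalEquality using (_≡_; refl; sym; subst; subst₂)
import Relation.Binary.Reasoning.Setoid as ≈-Reasoning

-- Univariate polynomials over a commutative ring.

module Polynomials {c ℓ} (R : CommutativeRing c ℓ) where

  private module R = CommutativeRing R
  open R using (Carrier; _≈_; _+_; _*_; 0#; 1#; semiring)
  open import Algebra.Properties.Semiring.Exp semiring using (_^_; ^-congˡ)
  open import Algebra.Properties.Semiring.Sum semiring using (sum-syntax; sum-cong-≋; *-distribˡ-sum)
  open ≈-Reasoning R.setoid

  open import Algebra.Solver.Ring.NaturalCoefficients.Default R.commutativeSemiring using (solve; _:+_; _:*_; _:=_)

  -- Coefficients from the constant term upwards. Trailing zeros are allowed, so a polynomial has
  -- many lists, and every law below is stated through `eval` or `coeff`.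
  Poly : Set c
  Poly = List Carrier

  infixl 6 _⊕_
  infixl 7 _⊗_
  infixr 8 _⊛_

  eval : Poly → Carrier → Carrier
  eval []      u = 0#
  eval (x ∷ P) u = x + u * eval P u

  coeff : Poly → ℕ → Carrier
  coeff []      _       = 0#
  coeff (x ∷ P) zero    = x
  coeff (x ∷ P) (suc i) = coeff P i

  _⊕_ : Poly → Poly → Poly
  []      ⊕ Q       = Q
  (x ∷ P) ⊕ []      = x ∷ P
  (x ∷ P) ⊕ (y ∷ Q) = x + y ∷ P ⊕ Q

  scale : Carrier → Poly → Poly
  scale x = map (x *_)

  _⊗_ : Poly → Poly → Poly
  []      ⊗ Q = []
  (x ∷ P) ⊗ Q = scale x Q ⊕ (0# ∷ P ⊗ Q)

  _⊛_ : Poly → ℕ → Poly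
  P ⊛ zero  = 1# ∷ []
  P ⊛ suc n = P ⊗ P ⊛ n

  eval-const : ∀ x u → eval (x ∷ []) u ≈ x
  eval-const x u = R.trans (R.+-congˡ (R.zeroʳ u)) (R.+-identityʳ x)

  eval-⊕ : ∀ P Q u → eval (P ⊕ Q) u ≈ eval P u + eval Q u
  eval-⊕ []      Q       u = R.sym (R.+-identityˡ _)
  eval-⊕ (x ∷ P) []      u = R.sym (R.+-identityʳ _)
  eval-⊕ (x ∷ P) (y ∷ Q) u = R.trans
    (R.+-congˡ (R.*-congˡ (eval-⊕ P Q u))) (alg x y u (eval P u) (eval Q u))
    where
    alg : ∀ x y u a b → (x + y) + u * (a + b) ≈ (x + u * a) + (y + u * b)
    alg = solve 5 (λ x y u a b → (x :+ y) :+ u :* (a :+ b) := (x :+ u :* a) :+ (y :+ u :* b)) R.refl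

  eval-scale : ∀ x P u → eval (scale x P) u ≈ x * eval P u
  eval-scale x []      u = R.sym (R.zeroʳ x)
  eval-scale x (y ∷ P) u = R.trans (R.+-congˡ (R.*-congˡ (eval-scale x P u))) (alg x y u (eval P u))
    where
    alg : ∀ x y u a → x * y + u * (x * a) ≈ x * (y + u * a)
    alg = solve 4 (λ x y u a → x :* y :+ u :* (x :* a) := x :* (y :+ u :* a)) R.refl

  eval-⊗ : ∀ P Q u → eval (P ⊗ Q) u ≈ eval P u * eval Q u
  eval-⊗ []      Q u = R.sym (R.zeroˡ _)
  eval-⊗ (x ∷ P) Q u = begin
    eval (scale x Q ⊕ (0# ∷ P ⊗ Q)) u               ≈⟨ eval-⊕ (scale x Q) (0# ∷ P ⊗ Q) u ⟩
    eval (scale x Q) u + (0# + u * eval (P ⊗ Q) u)  ≈⟨ R.+-cong (eval-scale x Q u) (R.+-identityˡ _) ⟩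
    x * eval Q u + u * eval (P ⊗ Q) u               ≈⟨ R.+-congˡ (R.*-congˡ (eval-⊗ P Q u)) ⟩
    x * eval Q u + u * (eval P u * eval Q u)        ≈⟨ alg x u (eval P u) (eval Q u) ⟩
    (x + u * eval P u) * eval Q u                   ∎
    where
    alg : ∀ x u a b → x * b + u * (a * b) ≈ (x + u * a) * b
    alg = solve 4 (λ x u a b → x :* b :+ u :* (a :* b) := (x :+ u :* a) :* b) R.refl

  eval-⊛ : ∀ P n u → eval (P ⊛ n) u ≈ eval P u ^ n
  eval-⊛ P zero    u = eval-const 1# u
  eval-⊛ P (suc n) u = R.trans (eval-⊗ P (P ⊛ n) u) (R.*-congˡ (eval-⊛ P n u))

  coeff-⊕ : ∀ P Q i → coeff (P ⊕ Q) i ≈ coeff P i + coeff Q i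
  coeff-⊕ []      Q       i       = R.sym (R.+-identityˡ _)
  coeff-⊕ (x ∷ P) []      i       = R.sym (R.+-identityʳ _)
  coeff-⊕ (x ∷ P) (y ∷ Q) zero    = R.refl
  coeff-⊕ (x ∷ P) (y ∷ Q) (suc i) = coeff-⊕ P Q i

  coeff-scale : ∀ x P i → coeff (scale x P) i ≈ x * coeff P i
  coeff-scale x []      i       = R.sym (R.zeroʳ x)
  coeff-scale x (y ∷ P) zero    = R.refl
  coeff-scale x (y ∷ P) (suc i) = coeff-scale x P i

  coeff-beyond-length : ∀ P {i} → length P ≤ i → coeff P i ≡ 0#
  coeff-beyond-length []      _       = refl
  coeff-beyond-length (x ∷ P) (s≤s h) = coeff-beyond-length P h

  -- The bound `N` is left free because the value of a power series is a limit over all large boxes.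
  eval≈∑coeff : ∀ P u {N} → length P ≤ N → eval P u ≈ ∑[ i < N ] (coeff P (toℕ i) * u ^ toℕ i)
  eval≈∑coeff []      u {zero}  _ = R.refl
  eval≈∑coeff []      u {suc N} _ = R.sym (R.trans
    (R.+-cong (R.zeroˡ 1#)
      -- Each tail term is `0#` times a power of `u`; lowering that power by one turns the tail into
      -- the sum for `[]` with bound `N`.
      (R.trans (sum-cong-≋ {N} λ i → R.trans (R.zeroˡ _) (R.sym (R.zeroˡ _)))
               (R.sym (eval≈∑coeff [] u {N} z≤n))))
    (R.+-identityˡ 0#))
  eval≈∑coeff (x ∷ P) u {suc N} (s≤s h) = R.+-cong (R.sym (R.*-identityʳ x)) (begin
    u * eval P u                                    ≈⟨ R.*-congˡ (eval≈∑coeff P u h) ⟩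
    u * ∑[ i < N ] (coeff P (toℕ i) * u ^ toℕ i)    ≈⟨ *-distribˡ-sum {N} u (λ i → coeff P (toℕ i) * u ^ toℕ i) ⟩
    ∑[ i < N ] (u * (coeff P (toℕ i) * u ^ toℕ i))  ≈⟨ sum-cong-≋ {N} (λ i → alg u (coeff P (toℕ i)) (u ^ toℕ i)) ⟩
    ∑[ i < N ] (coeff P (toℕ i) * (u * u ^ toℕ i))  ∎)
    where
    alg : ∀ u a b → u * (a * b) ≈ a * (u * b)
    alg = solve 3 (λ u a b → u :* (a :* b) := a :* (u :* b)) R.refl

  -- (Pⁿ − cⁿ)/(P − c) = Σ cⁿ⁻¹⁻ʲ Pʲ
  powerQuotient : Carrier → Poly → ℕ → Poly
  powerQuotient c P zero    = []
  powerQuotient c P (suc n) = scale c (powerQuotient c P n) ⊕ P ⊛ n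

  -- Induction through `x * xⁿ = c * xⁿ + e * xⁿ`: the first summand is expanded again, the second
  -- already carries the factor `e`. The increment stays visible as a factor, so any power of `p`
  -- dividing `e` survives in `xⁿ - cⁿ`.
  ^-expand : ∀ {x c e} P u → x ≈ eval P u → x ≈ c + e →
    ∀ n → x ^ n ≈ c ^ n + e * eval (powerQuotient c P n) u
  ^-expand {e = e} P u x≈P x≈c+e zero = R.sym (R.trans (R.+-congˡ (R.zeroʳ e)) (R.+-identityʳ 1#))
  ^-expand {x} {c} {e} P u x≈P x≈c+e (suc n) = begin
    x * x ^ n                              ≈⟨ R.*-congʳ x≈c+e ⟩
    (c + e) * x ^ n                        ≈⟨ R.distribʳ (x ^ n) c e ⟩
    c * x ^ n + e * x ^ n                  ≈⟨ R.+-congʳ (R.*-congˡ (^-expand P u x≈P x≈c+e n)) ⟩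
    c * (c ^ n + e * H) + e * x ^ n        ≈⟨ alg c (c ^ n) e H (x ^ n) ⟩
    c * c ^ n + e * (c * H + x ^ n)        ≈⟨ R.+-congˡ (R.*-congˡ (R.+-cong (eval-scale c H′ u) (R.trans (eval-⊛ P n u) (^-congˡ n (R.sym x≈P))))) ⟨
    c * c ^ n + e * (eval (scale c H′) u + eval (P ⊛ n) u)
                                           ≈⟨ R.+-congˡ (R.*-congˡ (eval-⊕ (scale c H′) (P ⊛ n) u)) ⟨
    c * c ^ n + e * eval (powerQuotient c P (suc n)) u  ∎
    where
    H′ = powerQuotient c P n
    H  = eval H′ u
    alg : ∀ c d e h y → c * (d + e * h) + e * y ≈ c * d + e * (c * h + y)
    alg = solve 5 (λ c d e h y → c :* (d :+ e :* h) :+ e :* y := c :* d :+ e :* (c :* h :+ y)) R.refl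

  monomialᴾ : ∀ {k} → Vec Poly k → Vec ℕ k → Poly
  monomialᴾ []       []      = 1# ∷ []
  monomialᴾ (P ∷ Ps) (i ∷ α) = P ⊛ i ⊗ monomialᴾ Ps α

  ∑ᴾ : (M : ℕ) → (ℕ → Poly) → Poly
  ∑ᴾ zero    g = []
  ∑ᴾ (suc M) g = g 0 ⊕ ∑ᴾ M (g ∘ suc)

  ∑boxᴾ : ∀ k → ℕ → (Vec ℕ k → Poly) → Poly
  ∑boxᴾ zero    M g = g []
  ∑boxᴾ (suc k) M g = ∑ᴾ M (λ i → ∑boxᴾ k M (λ α → g (i ∷ α)))

module PadicAnalysis (p : ℕ) (p-prime : Prime p) where

  open Padic p p-prime
  open Polynomials ℤₚ-ring
  open import Algebra.Properties.Semiring.Sum semiring using (sum-cong-≋)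
  open import Algebra.Properties.Semiring.Exp semiring using (^-congˡ)
  open import Algebra.Properties.Ring (CommutativeRing.ring ℤₚ-ring) using (-1*x≈-x)
  private
    module R = CommutativeRing ℤₚ-ring
    instance
      p≢0 : NonZero p
      p≢0 = prime⇒nonZero p-prime

    p^∣p^suc : ∀ n → p^ n ∣ℤ p^ (suc n)
    p^∣p^suc n = divides (+ p) (ℤ.pos-* p (p ℕ.^ n))

  -- Congruence modulo `pⁿ` in `ℤₚ`.

  infix 4 _≈[_]_

  -- The residue at `n` alone determines the class modulo `pⁿ`, so the norm condition on `x - y`
  -- becomes a divisibility of integers; `∣-∣⇒≈[]` and `≈[]⇒∣-∣` translate.
  record _≈[_]_ (x : ℤₚ) (n : ℕ) (y : ℤₚ) : Set where
    no-eta-equality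
    constructor mk≈[]
    field
      agreeAt : p^ n ∣ℤ residue x n ℤ.- residue y n

  open _≈[_]_

  ≈⇒≈[] : ∀ {n x y} → x ≈ y → x ≈[ n ] y
  ≈⇒≈[] {n} h = mk≈[] (agree h n)

  ≈[]-setoid : ℕ → Setoid 0ℓ 0ℓ
  ≈[]-setoid n = record
    { Carrier = ℤₚ
    ; _≈_ = _≈[ n ]_
    ; isEquivalence = record
      { refl  = ≈⇒≈[] R.refl
      ; sym   = λ {x} {y} h → mk≈[] (subst (p^ n ∣ℤ_) (sym-diff (residue x n) (residue y n)) (ℤ∣.∣m⇒∣-m (agreeAt h)))
      ; trans = λ {x} {y} {z} h h′ → mk≈[] (subst (p^ n ∣ℤ_) (trans-diff (residue x n) (residue y n) (residue z n))
                  (ℤ∣.∣m∣n⇒∣m+n (agreeAt h) (agreeAt h′)))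
      }
    }
    where
    sym-diff : ∀ a c → ℤ.- (a ℤ.- c) ≡ c ℤ.- a
    sym-diff = solve-ℤ
    trans-diff : ∀ a b c → (a ℤ.- b) ℤ.+ (b ℤ.- c) ≡ a ℤ.- c
    trans-diff = solve-ℤ

  private module S n = Setoid (≈[]-setoid n)

  +-cong-≈[] : ∀ {n x x′ y y′} → x ≈[ n ] x′ → y ≈[ n ] y′ → x + y ≈[ n ] x′ + y′
  +-cong-≈[] {n} {x} {x′} {y} {y′} h h′ = mk≈[]
    (subst (p^ n ∣ℤ_) (diff (residue x n) (residue x′ n) (residue y n) (residue y′ n))
      (ℤ∣.∣m∣n⇒∣m+n (agreeAt h) (agreeAt h′)))
    where
    diff : ∀ a b c d → (a ℤ.- b) ℤ.+ (c ℤ.- d) ≡ (a ℤ.+ c) ℤ.- (b ℤ.+ d)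
    diff = solve-ℤ

  *-congʳ-≈[] : ∀ {n x x′} y → x ≈[ n ] x′ → x * y ≈[ n ] x′ * y
  *-congʳ-≈[] {n} {x} {x′} y h = mk≈[]
    (subst (p^ n ∣ℤ_) (diff (residue x n) (residue x′ n) (residue y n)) (ℤ∣.∣m⇒∣m*n (residue y n) (agreeAt h)))
    where
    diff : ∀ a b c → (a ℤ.- b) ℤ.* c ≡ a ℤ.* c ℤ.- b ℤ.* c
    diff = solve-ℤ

  ∑-cong-≈[] : ∀ {n} M {f g : Fin M → ℤₚ} → (∀ i → f i ≈[ n ] g i) → ∑[ i < M ] f i ≈[ n ] ∑[ i < M ] g i
  ∑-cong-≈[] {n} zero    h = S.refl n
  ∑-cong-≈[]     (suc M) h = +-cong-≈[] (h zero) (∑-cong-≈[] M (h ∘ suc))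

  -- By compatibility, passing from level `suc n` to level `n` changes each residue by a multiple of
  -- `pⁿ`.
  agreeAt-suc⇒≈[] : ∀ {n x y} → p^ n ∣ℤ residue x (suc n) ℤ.- residue y (suc n) → x ≈[ n ] y
  agreeAt-suc⇒≈[] {n} {x} {y} h = mk≈[] (subst (p^ n ∣ℤ_)
    (diff (residue x (suc n)) (residue x n) (residue y (suc n)) (residue y n))
    (ℤ∣.∣m∣n⇒∣m+n (ℤ∣.∣m∣n⇒∣m-n h (compatible x n)) (compatible y n)))
    where
    diff : ∀ a b c d → ((a ℤ.- c) ℤ.- (a ℤ.- b)) ℤ.+ (c ℤ.- d) ≡ b ℤ.- d
    diff = solve-ℤ

  ≈[]-pred : ∀ {n x y} → x ≈[ suc n ] y → x ≈[ n ] y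
  ≈[]-pred {n} h = agreeAt-suc⇒≈[] (ℤ∣.∣-trans (p^∣p^suc n) (agreeAt h))

  ∣-∣⇒≈[] : ∀ {n x y} → ∣ x - y ∣≤p^- n → x ≈[ n ] y
  ∣-∣⇒≈[] {n} {x} {y} h = mk≈[] (p#^n∣x⇒pⁿ∣residue n (x - y) h)

  ≈[]⇒∣-∣ : ∀ {n x y} → x ≈[ n ] y → ∣ x - y ∣≤p^- n
  ≈[]⇒∣-∣ {n} {x} {y} h = pⁿ∣residue⇒p#^n∣x n (x - y) (agreeAt h)

  ∣∣⇒≈[]0 : ∀ {n x} → ∣ x ∣≤p^- n → x ≈[ n ] 0#
  ∣∣⇒≈[]0 {n} {x} h = mk≈[] (subst (p^ n ∣ℤ_) (sym (ℤ.+-identityʳ _)) (p#^n∣x⇒pⁿ∣residue n x h))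

  ≈[]0⇒∣∣ : ∀ {n x} → x ≈[ n ] 0# → ∣ x ∣≤p^- n
  ≈[]0⇒∣∣ {n} {x} h = pⁿ∣residue⇒p#^n∣x n x (subst (p^ n ∣ℤ_) (ℤ.+-identityʳ _) (agreeAt h))

  -- Cancelling `p` from a congruence modulo `pⁿ⁺¹` leaves one modulo `pⁿ` between the residues at
  -- level `suc n`; `agreeAt-suc⇒≈[]` brings it down to level `n`.
  p#-cancelˡ : ∀ {x y} → p# * x ≈ p# * y → x ≈ y
  p#-cancelˡ {x} {y} h = mk≈ λ n → agreeAt (agreeAt-suc⇒≈[] {n} {x} {y} (cancelled n))
    where
    diff : ∀ a b c → c ℤ.* a ℤ.- c ℤ.* b ≡ c ℤ.* (a ℤ.- b)
    diff = solve-ℤ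
    cancelled : ∀ n → p^ n ∣ℤ residue x (suc n) ℤ.- residue y (suc n)
    cancelled n = ℤ∣.*-cancelˡ-∣ (+ p) (subst₂ _∣ℤ_ (ℤ.pos-* p (p ℕ.^ n))
      (diff (residue x (suc n)) (residue y (suc n)) (+ p)) (agree h (suc n)))

  -- Completeness of `ℤₚ`, with an explicit modulus of convergence.

  module Limit (s : ℕ → ℤₚ) (K : ℕ → ℕ) (cauchy : ∀ n M → K n ≤ M → s M ≈[ n ] s (K n)) where

    private
      consecutive : ∀ n → s (K (suc n)) ≈[ n ] s (K n)
      -- `K` is not assumed monotone, so both terms are compared with the term at the larger index.
      consecutive n = S.trans n
        (S.sym n (≈[]-pred (cauchy (suc n) (K n ⊔ K (suc n)) (ℕ.m≤n⊔m (K n) (K (suc n))))))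
        (cauchy n (K n ⊔ K (suc n)) (ℕ.m≤m⊔n (K n) (K (suc n))))
      diff : ∀ a b c → (a ℤ.- b) ℤ.+ (b ℤ.- c) ≡ a ℤ.- c
      diff = solve-ℤ

    -- From `K n` on the sequence is constant modulo `pⁿ`, so `s (K n)` already has the final class
    -- there.
    limit : ℤₚ
    limit .residue    n = residue (s (K n)) n
    limit .compatible n = subst (p^ n ∣ℤ_)
      (diff (residue (s (K (suc n))) (suc n)) (residue (s (K (suc n))) n) (residue (s (K n)) n))
      (ℤ∣.∣m∣n⇒∣m+n (compatible (s (K (suc n))) n) (agreeAt (consecutive n)))

    limit-≈[] : ∀ n M → K n ≤ M → limit ≈[ n ] s M
    limit-≈[] n M K≤M = mk≈[] (agreeAt (S.sym n (cauchy n M K≤M)))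

  -- Sums over boxes modulo `pⁿ`, and their images under additive maps.

  ∑-truncate : ∀ {n K M} (f g : ℕ → ℤₚ) → K ≤ M →
    (∀ i → f i ≈[ n ] g i) → (∀ i → K ≤ i → f i ≈[ n ] 0#) →
    ∑[ i < M ] f (toℕ i) ≈[ n ] ∑[ i < K ] g (toℕ i)
  ∑-truncate {n} {M = zero}  f g z≤n f≈g f≈0 = S.refl n
  ∑-truncate {n} {M = suc M} f g z≤n f≈g f≈0 = S.trans n
    (+-cong-≈[] (f≈0 0 z≤n) (∑-truncate {M = M} (f ∘ suc) (f ∘ suc) z≤n (λ _ → S.refl n) (λ i _ → f≈0 (suc i) z≤n)))
    (≈⇒≈[] (R.+-identityˡ 0#))
  ∑-truncate f g (s≤s K≤M) f≈g f≈0 =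
    +-cong-≈[] (f≈g 0) (∑-truncate (f ∘ suc) (g ∘ suc) K≤M (f≈g ∘ suc) (λ i K≤i → f≈0 (suc i) (s≤s K≤i)))

  ∑box-null : ∀ k {n} M (g : Vec ℕ k → ℤₚ) → (∀ α → g α ≈[ n ] 0#) → ∑box k M g ≈[ n ] 0#
  ∑box-null zero    M g g≈0 = g≈0 []
  ∑box-null (suc k) {n} M g g≈0 = ∑-truncate {n} {0} {M} row row z≤n (λ _ → S.refl n) (λ i _ → ∑box-null k M _ (λ α → g≈0 (i ∷ α)))
    where
    row : ℕ → ℤₚ
    row i = ∑box k M (λ α → g (i ∷ α))

  -- A multi-index outside the box of side `K` has an entry, hence an entry sum, of at least `K`, so
  -- its term vanishes modulo `pⁿ`.
  ∑box-truncate : ∀ k {n K M} (g : Vec ℕ k → ℤₚ) → K ≤ M →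
    (∀ α → K ≤ sum α → g α ≈[ n ] 0#) → ∑box k M g ≈[ n ] ∑box k K g
  ∑box-truncate zero    {n} g K≤M g≈0 = S.refl n
  -- Rows with first index at least `K` vanish, and the remaining rows shrink from side `M` to side
  -- `K`; this is why `∑-truncate` compares two families.
  ∑box-truncate (suc k) {n} {K} {M} g K≤M g≈0 = ∑-truncate
    (λ i → ∑box k M (λ α → g (i ∷ α))) (λ i → ∑box k K (λ α → g (i ∷ α))) K≤M
    (λ i → ∑box-truncate k (λ α → g (i ∷ α)) K≤M (λ α h → g≈0 (i ∷ α) (ℕ.≤-trans h (ℕ.m≤n+m (sum α) i))))
    (λ i K≤i → ∑box-null k M (λ α → g (i ∷ α)) (λ α → g≈0 (i ∷ α) (ℕ.≤-trans K≤i (ℕ.m≤m+n i (sum α)))))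

  ∑box-cong : ∀ k M {g g′ : Vec ℕ k → ℤₚ} → (∀ α → g α ≈ g′ α) → ∑box k M g ≈ ∑box k M g′
  ∑box-cong zero    M h = h []
  ∑box-cong (suc k) M h = sum-cong-≋ {M} (λ i → ∑box-cong k M (λ α → h (toℕ i ∷ α)))

  module _ (h : Poly → ℤₚ) (h-[] : h [] ≈ 0#) (h-⊕ : ∀ P Q → h (P ⊕ Q) ≈ h P + h Q) where

    ∑-homo : ∀ M (g : ℕ → Poly) → h (∑ᴾ M g) ≈ ∑[ i < M ] h (g (toℕ i))
    ∑-homo zero    g = h-[]
    ∑-homo (suc M) g = R.trans (h-⊕ (g 0) _) (R.+-congˡ (∑-homo M (g ∘ suc)))

    -- Used with `h` a coefficient, to get convergence, and with `h` an evaluation, to recover the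
    -- partial sums of `F`.
    ∑box-homo : ∀ k M (g : Vec ℕ k → Poly) → h (∑boxᴾ k M g) ≈ ∑box k M (h ∘ g)
    ∑box-homo zero    M g = R.refl
    ∑box-homo (suc k) M g = R.trans (∑-homo M _) (sum-cong-≋ {M} (λ i → ∑box-homo k M (λ α → g (toℕ i ∷ α))))

  eval-monomialᴾ : ∀ {k} u {xs : Vec ℤₚ k} {Ps} → Pointwise (λ x P → x ≈ eval P u) xs Ps →
    ∀ α → eval (monomialᴾ Ps α) u ≈ monomial xs α
  eval-monomialᴾ u []                          []      = eval-const 1# u
  eval-monomialᴾ u {Ps = P ∷ Ps} (x≈P ∷ xs≈Ps) (i ∷ α) = R.trans (eval-⊗ (P ⊛ i) (monomialᴾ Ps α) u)
    (R.*-cong (R.trans (eval-⊛ P i u) (^-congˡ i (R.sym x≈P))) (eval-monomialᴾ u xs≈Ps α))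

  -- Substitution of polynomials into a restricted power series.

  module Composition {k} (F : PowerSeries k) (F-restricted : Restricted F) (Ps : Vec Poly k) where

    private
      K : ℕ → ℕ
      K n = proj₁ (F-restricted n)

      term : Vec ℕ k → Poly
      term α = scale (F α) (monomialᴾ Ps α)

      partialSum : ℕ → Poly
      partialSum M = ∑boxᴾ k M term

      coeff-partialSum : ∀ i M → coeff (partialSum M) i ≈ ∑box k M (λ α → coeff (term α) i)
      coeff-partialSum i M = ∑box-homo (λ P → coeff P i) R.refl (λ P Q → coeff-⊕ P Q i) k M term

      -- The factor `F α` alone makes the coefficient small, so the bound `K n` does not depend on
      -- the degree `i`.
      term-small : ∀ i n α → K n ≤ sum α → coeff (term α) i ≈[ n ] 0#
      term-small i n α K≤α = begin
        coeff (term α) i                ≈⟨ ≈⇒≈[] (coeff-scale (F α) (monomialᴾ Ps α) i) ⟩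
        F α * coeff (monomialᴾ Ps α) i  ≈⟨ *-congʳ-≈[] _ (∣∣⇒≈[]0 (proj₂ (F-restricted n) α K≤α)) ⟩
        0# * coeff (monomialᴾ Ps α) i   ≈⟨ ≈⇒≈[] (R.zeroˡ _) ⟩
        0#                              ∎
        where open ≈-Reasoning (≈[]-setoid n)

      cauchy : ∀ i n M → K n ≤ M → coeff (partialSum M) i ≈[ n ] coeff (partialSum (K n)) i
      cauchy i n M K≤M = begin
        coeff (partialSum M) i                   ≈⟨ ≈⇒≈[] (coeff-partialSum i M) ⟩
        ∑box k M (λ α → coeff (term α) i)        ≈⟨ ∑box-truncate k _ K≤M (term-small i n) ⟩
        ∑box k (K n) (λ α → coeff (term α) i)    ≈⟨ ≈⇒≈[] (coeff-partialSum i (K n)) ⟨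
        coeff (partialSum (K n)) i               ∎
        where open ≈-Reasoning (≈[]-setoid n)

      module L i = Limit (λ M → coeff (partialSum M) i) K (cauchy i)

      eval-partialSum : ∀ u {xs} → Pointwise (λ x P → x ≈ eval P u) xs Ps →
        ∀ M → eval (partialSum M) u ≈ ∑box k M (λ α → F α * monomial xs α)
      eval-partialSum u xs≈Ps M = R.trans
        (∑box-homo (λ P → eval P u) R.refl (λ P Q → eval-⊕ P Q u) k M term)
        (∑box-cong k M (λ α → R.trans (eval-scale (F α) (monomialᴾ Ps α) u) (R.*-congˡ (eval-monomialᴾ u xs≈Ps α))))

    composite : PowerSeries 1
    composite (i ∷ []) = L.limit i

    -- Modulo `pⁿ` all coefficients agree with those of the single polynomial `partialSum (K n)`,
    -- which are zero beyond its length.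
    composite-restricted : Restricted composite
    composite-restricted n = length (partialSum (K n)) , λ where
      (i ∷ []) D≤i → ≈[]0⇒∣∣ (S.trans n (L.limit-≈[] i n (K n) ℕ.≤-refl)
        (≈⇒≈[] (R.reflexive (coeff-beyond-length (partialSum (K n)) (subst (length (partialSum (K n)) ≤_) (ℕ.+-identityʳ i) D≤i)))))

    -- Modulo `pⁿ` both series are compared with one polynomial, `partialSum M`, so no two limits
    -- have to be interchanged.
    composite-value : ∀ u {xs y} → Pointwise (λ x P → x ≈ eval P u) xs Ps →
      F [ xs ]≈ y → composite [ u ∷ [] ]≈ y
    composite-value u {xs} {y} xs≈Ps F[xs]≈y n = length (partialSum M) , λ N D≤N → ≈[]⇒∣-∣ (begin
      ∑[ i < N ] (L.limit (toℕ i) * (u ^ toℕ i * 1#))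
        ≈⟨ ∑-cong-≈[] N (λ i → *-congʳ-≈[] _ (L.limit-≈[] (toℕ i) n M (ℕ.m≤m⊔n (K n) K′))) ⟩
      ∑[ i < N ] (coeff (partialSum M) (toℕ i) * (u ^ toℕ i * 1#))
        ≈⟨ ≈⇒≈[] (sum-cong-≋ {N} (λ i → R.*-congˡ (R.*-identityʳ (u ^ toℕ i)))) ⟩
      ∑[ i < N ] (coeff (partialSum M) (toℕ i) * u ^ toℕ i)
        ≈⟨ ≈⇒≈[] (eval≈∑coeff (partialSum M) u D≤N) ⟨
      eval (partialSum M) u
        ≈⟨ ≈⇒≈[] (eval-partialSum u xs≈Ps M) ⟩
      ∑box k M (λ α → F α * monomial xs α)
        ≈⟨ ∣-∣⇒≈[] (proj₂ (F[xs]≈y n) M (ℕ.m≤n⊔m (K n) K′)) ⟩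
      y ∎)
      where
      open ≈-Reasoning (≈[]-setoid n)
      K′ = proj₁ (F[xs]≈y n)
      -- Past `K n` the coefficients have reached their limits modulo `pⁿ`; past `K′` the box sums
      -- of `F` have reached `y`.
      M  = K n ⊔ K′

  -- The Fermat quotient of a polynomial expression.

  affine : ℤₚ → ℕ → Poly → Poly
  affine c n Q = (c ∷ []) ⊕ scale (p# ^ n) Q

  eval-affine : ∀ c n Q u → eval (affine c n Q) u ≈ c + p# ^ n * eval Q u
  eval-affine c n Q u = R.trans (eval-⊕ (c ∷ []) (scale (p# ^ n) Q) u)
    (R.+-cong (eval-const c u) (eval-scale (p# ^ n) Q u))

  -- With `P = affine c (suc n) Q`, this is `((P - c) - (Pᵖ - cᵖ))/pⁿ⁺¹` written without a division.
  δᴾ : ℤₚ → ℕ → Poly → Poly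
  δᴾ c n Q = Q ⊕ scale (R.- 1#) (Q ⊗ powerQuotient c (affine c (suc n) Q) p)

  -- Both `x - c` and `xᵖ - cᵖ` contain `pⁿ⁺¹`. One factor `p` is spent on the division in `δ`,
  -- which is carried out by cancelling `p#`.
  δ-affine : ∀ {x} c n Q u → x ≈ c + p# ^ suc n * eval Q u → δ x ≈ δ c + p# ^ n * eval (δᴾ c n Q) u
  δ-affine {x} c n Q u x≈ = p#-cancelˡ (begin
    p# * δ x
      ≈⟨ p*δa≈a-aᵖ x ⟩
    x - x ^ p
      ≈⟨ R.+-cong x≈ (R.-‿cong (^-expand P u (R.trans x≈ (R.sym (eval-affine c (suc n) Q u))) x≈ p)) ⟩
    (c + (p# * p# ^ n) * q) - (c ^ p + (p# * p# ^ n) * q * h)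
      ≈⟨ alg c (c ^ p) p# (p# ^ n) q h ⟩
    (c - c ^ p) + p# * (p# ^ n * (q + R.- (q * h)))
      ≈⟨ R.+-cong (p*δa≈a-aᵖ c) (R.*-congˡ (R.*-congˡ (R.trans (eval-⊕ Q (scale (R.- 1#) (Q ⊗ H)) u) (R.+-congˡ eval-second)))) ⟨
    p# * δ c + p# * (p# ^ n * eval (δᴾ c n Q) u)
      ≈⟨ R.distribˡ p# (δ c) (p# ^ n * eval (δᴾ c n Q) u) ⟨
    p# * (δ c + p# ^ n * eval (δᴾ c n Q) u) ∎)
    where
    open ≈-Reasoning R.setoid
    P = affine c (suc n) Q
    H = powerQuotient c P p
    q = eval Q u
    h = eval H u
    eval-second : eval (scale (R.- 1#) (Q ⊗ H)) u ≈ R.- (q * h)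
    eval-second = R.trans (eval-scale (R.- 1#) (Q ⊗ H) u) (R.trans (-1*x≈-x _) (R.-‿cong (eval-⊗ Q H u)))
    identity : ∀ c d e f q h →
      (c ℤ.+ (e ℤ.* f) ℤ.* q) ℤ.- (d ℤ.+ (e ℤ.* f) ℤ.* q ℤ.* h) ≡ (c ℤ.- d) ℤ.+ e ℤ.* (f ℤ.* (q ℤ.+ ℤ.- (q ℤ.* h)))
    identity = solve-ℤ
    alg : ∀ c d e f q h → (c + (e * f) * q) - (d + (e * f) * q * h) ≈ (c - d) + e * (f * (q + R.- (q * h)))
    -- The ring operations act residue by residue, so an integer identity gives equal
    -- representatives at every level.
    alg c d e f q h = mk≈ λ k → subst (p^ k ∣ℤ_)
      (sym (ℤ.i≡j⇒i-j≡0 (identity (residue c k) (residue d k) (residue e k) (residue f k) (residue q k) (residue h k))))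
      (divides (+ 0) refl)

  -- Each `δ` costs one power of `p`: the entry for `δⁱ` has the form `δⁱ c + pᵐ⁻ⁱ Qᵢ`, and the last
  -- one is reached with exponent `0`. Hence order `m` leads to level `m`.
  iterateδᴾ : (m : ℕ) → ℤₚ → Poly → Vec Poly (suc m)
  iterateδᴾ zero    c Q = affine c 0 Q ∷ []
  iterateδᴾ (suc m) c Q = affine c (suc m) Q ∷ iterateδᴾ m (δ c) (δᴾ c m Q)

  -- Here `x` is arbitrary up to `≈`, so that the induction can continue with `δ x`, which
  -- `δ-affine` puts in the same form with exponent one lower.
  iterateδ≈eval : ∀ m {x} c Q u → x ≈ c + p# ^ m * eval Q u →
    Pointwise (λ y P → y ≈ eval P u) (iterate δ x (suc m)) (iterateδᴾ m c Q)
  iterateδ≈eval zero    c Q u x≈ = R.trans x≈ (R.sym (eval-affine c 0 Q u)) ∷ []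
  iterateδ≈eval (suc m) c Q u x≈ = R.trans x≈ (R.sym (eval-affine c (suc m) Q u))
    ∷ iterateδ≈eval m (δ c) (δᴾ c m Q) u (δ-affine c m Q u x≈)

  ADO⇒analytic : ∀ m f → IsArithmeticDifferentialOperator m f → IsAnalytic m f
  ADO⇒analytic m f (F , F-restricted , F[]≈f) a = composite , composite-restricted , λ u →
    composite-value u (iterateδ≈eval m a X u (R.+-congˡ (R.*-congˡ (R.sym (eval-X u))))) (F[]≈f (a + p# ^ m * u))
    where
    -- The indeterminate. Starting from `a + pᵐ X`, the polynomials depend on `a` but not on `u`, so
    -- one series serves every `u`.
    X : Poly
    X = 0# ∷ 1# ∷ []
    open Composition F F-restricted (iterateδᴾ m a X)
    eval-X : ∀ u → eval X u ≈ u
    eval-X u = R.trans (R.+-identityˡ _) (R.trans (R.*-congˡ (eval-const 1# u)) (R.*-identityʳ u))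

theorem1p4 : (p : ℕ) (p-prime : Prime p) → let open Padic p p-prime in
    (m : ℕ) (f : Func setoid setoid) →
    IsArithmeticDifferentialOperator m f → IsAnalytic m f
theorem1p4 p p-prime = PadicAnalysis.ADO⇒analytic p p-prime
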